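{- Algorithm Pruned-S-kSSP (described in the context), whose input is a directed non-negatively weighted graph $G=(V,E,\omega)$, a root $r\in V$ and an integer $k>0$, solves the Single-Source Top-$k$ Simple Shortest Paths problem.
   Context: $G=(V,E,\omega)$ is a finite directed non-negatively weighted graph, $E\subseteq V\times V$, $\omega:E\to\mathbb{R}^+$; $N^+(v)=\{u\in V:(v,u)\in E\}$ and $N^-(v)=\{u\in V:(u,v)\in E\}$. A path from $s$ to $t$ is a vertex sequence $P=(s=v_1,\dots,v_\eta=t)$ with $(v_i,v_{i+1})\in E$ for all $i<\eta$; $V(P)$ is its vertex set; it is simple if it has no repeated vertex; its weight is $\omega(P)=\sum_{i=1}^{\eta-1}\omega(v_i,v_{i+1})$. For a path $\Pi$ ending at $v$ and an edge $(v,u)$, $\Pi\oplus(u)$ is $\Pi$ extended by $u$. A collection of top-$k$ simple shortest paths from $r$ to $v$ is a set of pairwise distinct simple paths from $r$ to $v$ that consists of all simple $r$–$v$ paths if there are fewer than $k$ of them, and otherwise consists of exactly $k$ simple $r$–$v$ paths such that every simple $r$–$v$ path not in the set has weight at least that of every path in the set. The Single-Source Top-$k$ Simple Shortest Paths problem asks for such a collection for each $v\in V\setminus\{r\}$. Algorithm Pruned-S-kSSP. Maintain a list $T_v$ for each $v\in V$ (initially empty) and a min-priority queue $PQ$ of paths keyed by weight, initially containing only the trivial path $(r)$ with key $0$. While $PQ\ne\emptyset$ and there is $w\neq r$ with $|T_w|<k$: remove from $PQ$ a path $\Pi=(r,\dots,v)$ of minimum weight; if the procedure $\mathrm{Pruning}(v)$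 does not return true, then for each $u\in N^+(v)\setminus V(\Pi)$ insert $\Pi\oplus(u)$ into $PQ$ with key $\omega(\Pi)+\omega(v,u)$; then, if $|T_v|<k$, add $\Pi$ to $T_v$. The output is the list $T_v$ for each $v\in V\setminus\{r\}$. Procedure $\mathrm{Pruning}(v)$. Write $V(T_x)=\bigcup_{P\in T_x}V(P)$ for the current lists. Start with a FIFO queue $Q$ containing only $v$ and a set $\mathrm{seen}=\{v\}$. While $Q\neq\emptyset$: remove the head $x$ of $Q$; if $|T_x|<k$ and $x\neq r$, return false; for each $u\in N^-(x)$ with $u\notin\mathrm{seen}$, if $u\in V(T_x)$ then append $u$ to $Q$ and add $u$ to $\mathrm{seen}$. If the loop ends, return true. (The intended meaning of the output is: true if and only if all general predecessors of $v$ are saturated, where $x$ is saturated when $|T_x|=k$, the predecessors of a vertex $x$ are the vertices other than $x$ on the paths of its collection, and the general predecessors of $v$ are $v$ and all vertices related to $v$ by the transitive closure of the predecessor relation.)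
   Formalization: In Pruning(v), r is exempt from the test |T_x|<k only when r ≠ v, and every unseen u ∈ V(T_x) is followed, not only those in N^-(x); both changes follow the intended meaning of Pruning, and without them the algorithm returns wrong lists. -}

module Defs where

open import Algebra.Structures using (IsCommutativeMonoid)
open import Data.Bool.Base using (Bool; true; false; if_then_else_)
open import Data.Fin.Base using (Fin)
open import Data.Fin.Properties using (_≟_)
open import Data.List.Base using (List; []; _∷_; _++_; [_]; length; concatMap; mapMaybe; filter; allFin)
open import Data.List.Membership.Propositional using (_∈_; _∉_)
open import Data.List.Relation.Binary.Permutation.Propositional using (_↭_)
open import Data.List.Relation.Unary.All using (All)
open import Data.List.Relation.Unary.Unique.Propositional using (Unique)
open import Data.Maybe.Base using (Maybe; just; nothing)
open import Data.Nat.Base using (ℕ) renaming (_<_ to _<ℕ_)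
open import Data.Nat.Properties using () renaming (_<?_ to _<ℕ?_)
open import Data.Product.Base using (_×_; _,_; ∃; proj₂)
open import Data.Sum.Base using (_⊎_)
open import Function.Base using (flip)
open import Induction.WellFounded using (Acc)
open import Level using (Level; suc; _⊔_; 0ℓ)
open import Relation.Binary.Core using (Rel; _Preserves₂_⟶_⟶_)
open import Relation.Binary.Construct.Closure.ReflexiveTransitive using (Star)
open import Relation.Binary.Definitions using (Decidable)
open import Relation.Binary.PropositionalEquality using (_≡_; _≢_; refl)
open import Relation.Binary.Structures using (IsTotalOrder)
open import Relation.Nullary using (¬_; yes; no)
open import Relation.Nullary.Decidable using (_×-dec_; ¬?)

import Data.List.Membership.DecPropositional as DecMembership

private variable
  c ℓ₁ ℓ₂ : Level

-- The only structure of ℝ that the problem and the algorithm refer to: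
-- addition, zero and a total order compatible with addition.
record WeightDomain c ℓ₁ ℓ₂ : Set (suc (c ⊔ ℓ₁ ⊔ ℓ₂)) where
  infix  4 _≈_ _≤_
  infixl 6 _+_
  field
    Carrier             : Set c
    _≈_                 : Rel Carrier ℓ₁
    _≤_                 : Rel Carrier ℓ₂
    _+_                 : Carrier → Carrier → Carrier
    0#                  : Carrier
    isCommutativeMonoid : IsCommutativeMonoid _≈_ _+_ 0#
    isTotalOrder        : IsTotalOrder _≈_ _≤_
    +-mono-≤            : _+_ Preserves₂ _≤_ ⟶ _≤_ ⟶ _≤_

-- The edge argument of ω is irrelevant: E is a subset of V × V, so a pair of
-- vertices carries at most one weight.
record Graph (W : WeightDomain c ℓ₁ ℓ₂) : Set (c ⊔ ℓ₂ ⊔ suc 0ℓ) where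
  open WeightDomain W using (Carrier; _≤_; 0#)
  infix 4 _⟶_ _⟶?_
  field
    n        : ℕ

  V : Set
  V = Fin n

  field
    _⟶_      : Rel V 0ℓ
    _⟶?_     : Decidable _⟶_
    ω        : (u v : V) → .(u ⟶ v) → Carrier
    ω-nonNeg : ∀ u v .(e : u ⟶ v) → 0# ≤ ω u v e

module Paths {W : WeightDomain c ℓ₁ ℓ₂} (G : Graph W) where
  open WeightDomain W using (Carrier; _≤_; _+_; 0#)
  open Graph G
  open DecMembership (_≟_ {n}) using (_∈?_) public

  -- Edge proofs are irrelevant, so propositional equality of paths is equality
  -- of vertex sequences.
  infixl 5 _⊕_,_
  data Path (s : V) : V → Set where
    trivial : Path s s
    _⊕_,_   : ∀ {v} → Path s v → (u : V) → .(v ⟶ u) → Path s u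

  -- Listed from the endpoint back to the source.
  vertices : ∀ {s t} → Path s t → List V
  vertices {s} trivial     = [ s ]
  vertices     (P ⊕ u , _) = u ∷ vertices P

  weight : ∀ {s t} → Path s t → Carrier
  weight trivial             = 0#
  weight (_⊕_,_ {v} P u v⟶u) = weight P + ω v u v⟶u

  Simple : ∀ {s t} → Path s t → Set
  Simple P = Unique (vertices P)

  FewerSimplePathsThan : ℕ → V → V → Set
  FewerSimplePathsThan k s t =
    (Ps : List (Path s t)) → Unique Ps → All Simple Ps → length Ps <ℕ k

  record IsTopK (k : ℕ) {s t : V} (Ps : List (Path s t)) : Set ℓ₂ where
    field
      distinct : Unique Ps
      simple   : All Simple Ps
      few      : FewerSimplePathsThan k s t → ∀ P → Simple P → P ∈ Ps
      many     : ¬ FewerSimplePathsThan k s t →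
                 length Ps ≡ k ×
                 (∀ P → Simple P → P ∉ Ps → All (λ Q → weight Q ≤ weight P) Ps)

module PrunedSkSSP {W : WeightDomain c ℓ₁ ℓ₂} (G : Graph W) (r : Graph.V G) (k : ℕ) where
  open WeightDomain W using (_≤_)
  open Graph G
  open Paths G

  Lists : Set
  Lists = (v : V) → List (Path r v)

  V[_] : ∀ {x} → List (Path r x) → List V
  V[ Ps ] = concatMap vertices Ps

  module _ (T : Lists) where

    -- r never gets more than one path, so it is exempt when it is met as a
    -- predecessor; it is not exempt as the queried vertex v, as otherwise the
    -- initial path (r) would be pruned and nothing explored.
    Unsaturated : (v x : V) → Set
    Unsaturated v x = length (T x) <ℕ k × (x ≢ r ⊎ x ≡ v)

    -- All vertices of V[ T x ] are followed, not only the in-neighbours of x: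
    -- T x may contain a path whose prefix ending at the in-neighbour y is not
    -- in T y, so restricting to in-neighbours can miss general predecessors.
    unseen : V → List V → List V
    unseen x seen = filter (λ u → ¬? (u ∈? seen) ×-dec (u ∈? V[ T x ])) (allFin n)

    -- PruningLoop v Q seen b: started with FIFO queue Q and set seen, the loop
    -- returns b.
    data PruningLoop (v : V) : List V → List V → Bool → Set where
      exhausted   : ∀ {seen} → PruningLoop v [] seen true
      unsaturated : ∀ {x Q seen} → Unsaturated v x →
                    PruningLoop v (x ∷ Q) seen false
      next        : ∀ {x Q seen b} → ¬ Unsaturated v x →
                    PruningLoop v (Q ++ unseen x seen) (seen ++ unseen x seen) b →
                    PruningLoop v (x ∷ Q) seen b

    Pruning : V → Bool → Set
    Pruning v = PruningLoop v [ v ] [ v ]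

  record State : Set where
    constructor ⟨_,_⟩
    field
      queue : List (∃ (Path r))
      lists : Lists
  open State public

  initial : State
  initial = ⟨ [ (r , trivial) ] , (λ _ → []) ⟩

  Guard : State → Set
  Guard ⟨ PQ , T ⟩ = PQ ≢ [] × ∃ λ w → w ≢ r × length (T w) <ℕ k

  extend : ∀ {v} → Path r v → V → Maybe (∃ (Path r))
  extend {v} Π u with v ⟶? u | u ∈? vertices Π
  ... | yes v⟶u | no _ = just (u , (Π ⊕ u , v⟶u))
  ... | _       | _    = nothing

  extensions : ∀ {v} → Path r v → List (∃ (Path r))
  extensions Π = mapMaybe (extend Π) (allFin n)

  add : ∀ {v} → Path r v → Lists → Lists
  add {v} Π T w with v ≟ w | length (T w) <ℕ? k
  ... | yes refl | yes _ = T v ++ [ Π ]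
  ... | _        | _     = T w

  -- The key of a queued path is its weight; ties between paths of minimum
  -- weight are broken arbitrarily, hence a relation.
  data Step : State → State → Set ℓ₂ where
    step : ∀ {PQ T v} {Π : Path r v} {rest b} →
           Guard ⟨ PQ , T ⟩ →
           PQ ↭ (v , Π) ∷ rest →
           All (λ Π′ → weight Π ≤ weight (proj₂ Π′)) rest →
           Pruning T v b →
           Step ⟨ PQ , T ⟩
                ⟨ (if b then rest else extensions Π ++ rest) , add Π T ⟩

  Reachable : State → Set ℓ₂
  Reachable = Star Step initial

  -- Total correctness: no run is infinite, no run gets stuck while the guard
  -- holds (in particular every call of Pruning returns), and whenever the main
  -- loop is left the lists are as required.
  record SolvesTopKSimpleShortestPaths : Set ℓ₂ where
    field
      terminates : Acc (flip Step) initial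
      progress   : ∀ {s} → Reachable s → Guard s → ∃ (Step s)
      correct    : ∀ {s} → Reachable s → ¬ Guard s →
                   ∀ v → v ≢ r → IsTopK k (lists s v)

module Submission where

-- Call a removed path expanded when it is not pruned. Listed paths are expanded:
-- a path to v is only listed while v itself is unsaturated, and then the pruning
-- search fails at once. Suppose P ▷ R is a simple path to an unsaturated vertex
-- w that is not listed there, and P is expanded. Follow R until it meets a queued
-- path or a pruned one. In the latter case let S be the set of vertices seen by
-- that pruning search and x the last vertex of R in S. The k paths listed for x
-- stay inside S, and the rest R′ of R after x avoids S, so following any of them
-- by R′ gives a simple path to w, no heavier than P ▷ R; as w is unsaturated, one
-- of these k paths is not listed for w. Its first part is expanded and R′ is
-- shorter than R, so by induction some queued path is no heavier than P ▷ R.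
-- Hence an unsaturated vertex has no missing path once the queue is empty, and a
-- path missing when its endpoint gets its k-th path, being no lighter than a
-- queued path, is no lighter than the minimum just removed.

open import Defs
open import Algebra.Structures using (IsCommutativeMonoid)
open import Data.Bool.Base using (true; false; if_then_else_)
open import Data.Empty using (⊥-elim-irr)
open import Data.Fin.Properties using () renaming (_≟_ to _≟ᶠ_)
open import Data.List.Base
  using (List; []; _∷_; _++_; [_]; length; map; mapMaybe; allFin)
import Data.List.Membership.DecPropositional as DecMembership
open import Data.List.Membership.Propositional using (_∈_; _∉_; find; lose)
open import Data.List.Membership.Propositional.Properties
  using ( ∈-∃++; ∈-++⁺ˡ; ∈-++⁺ʳ; ∈-++⁻; ∈-map⁻; ∈-filter⁺; ∈-filter⁻; ∈-allFin; ∈-concatMap⁺)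
open import Data.List.Properties
  using (∷-injective; ≡-dec; length-++; length-map; length-mapMaybe; length-tabulate; map-++)
open import Data.List.Relation.Binary.Permutation.Propositional
  using (_↭_; ↭-refl; ↭-sym; ↭-trans; ↭⇒↭ₛ; prep; swap)
open import Data.List.Relation.Binary.Permutation.Propositional.Properties
  using (∈-resp-↭; All-resp-↭; map⁺)
import Data.List.Relation.Binary.Permutation.Setoid.Properties as ↭ₛ
open import Data.List.Relation.Unary.All using (All; []; _∷_; lookup; tabulate; all?)
import Data.List.Relation.Unary.All as All
open import Data.List.Relation.Unary.All.Properties
  using (¬All⇒Any¬; ¬Any⇒All¬)
import Data.List.Relation.Unary.All.Properties as Allₚ
open import Data.List.Relation.Unary.AllPairs using ([]; _∷_)
open import Data.List.Relation.Unary.Any using (here; there)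
open import Data.List.Relation.Unary.Unique.Propositional using (Unique)
open import Data.List.Relation.Unary.Unique.Propositional.Properties
  using (Unique[x∷xs]⇒x∉xs; allFin⁺)
import Data.List.Relation.Unary.Unique.Propositional.Properties as Uniqueₚ
open import Data.Maybe.Base using (Maybe; just; nothing)
open import Data.Nat.Base using (ℕ; zero; suc; _+_; _*_; _∸_; _≤_; _<_; _>_; z≤n; s≤s)
open import Data.Nat.Induction using (<-wellFounded)
open import Data.Nat.ListAction using (sum)
open import Data.Nat.ListAction.Properties using (sum-++; sum-↭)
open import Data.Nat.Properties
  using ( _<?_; ≤-refl; ≤-reflexive; ≤-trans; <-≤-trans; <⇒≱; ≮⇒≥; ≤∧≮⇒≡; n≤1+n; m≤m+n
        ; +-suc; +-comm; +-assoc; +-mono-≤; +-monoˡ-≤; *-monoˡ-≤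
        ; +-∸-assoc; m+[n∸m]≡n; ∸-+-assoc; m+n≤o⇒m≤o∸n; module ≤-Reasoning)
open import Data.Product.Base using (Σ; ∃; _×_; _,_; proj₁; proj₂)
open import Data.Sum.Base using (_⊎_; inj₁; inj₂)
open import Data.Unit.Base using (⊤)
open import Function.Base using (_∘_; flip)
open import Induction.WellFounded using (Acc; acc)
open import Level using (_⊔_)
open import Relation.Binary.Construct.Closure.ReflexiveTransitive using (Star; ε; _◅_)
open import Relation.Binary.Definitions using (DecidableEquality)
open import Relation.Binary.PropositionalEquality
  using (_≡_; _≢_; refl; sym; trans; cong; cong₂; subst; setoid; module ≡-Reasoning)
open import Relation.Binary.Structures using (IsTotalOrder)
open import Relation.Nullary using (¬_; Dec; yes; no; contradiction)
open import Relation.Nullary.Decidable using (map′; _×-dec_; _⊎-dec_; ¬?)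

module _ {a} {A : Set a} where

  ∉⇒All≢ : ∀ {x : A} {xs} → x ∉ xs → All (x ≢_) xs
  ∉⇒All≢ = ¬Any⇒All¬ _

  Unique-resp-↭ : ∀ {xs ys : List A} → xs ↭ ys → Unique xs → Unique ys
  Unique-resp-↭ = ↭ₛ.Unique-resp-↭ (setoid A) ∘ ↭⇒↭ₛ

  unique-⊆⇒length≤ : ∀ {xs ys : List A} → Unique xs → (∀ {x} → x ∈ xs → x ∈ ys) →
                     length xs ≤ length ys
  unique-⊆⇒length≤ {[]}     _        _   = z≤n
  unique-⊆⇒length≤ {x ∷ xs} (x∉ ∷ u) sub with ∈-∃++ (sub (here refl))
  ... | ys₁ , ys₂ , refl = ≤-trans (s≤s (unique-⊆⇒length≤ u sub′)) (≤-reflexive eq)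
    where
    sub′ : ∀ {y} → y ∈ xs → y ∈ ys₁ ++ ys₂
    sub′ y∈ with ∈-++⁻ ys₁ (sub (there y∈))
    ... | inj₁ y∈₁         = ∈-++⁺ˡ y∈₁
    ... | inj₂ (here refl) = contradiction refl (lookup x∉ y∈)
    ... | inj₂ (there y∈₂) = ∈-++⁺ʳ ys₁ y∈₂
    eq : suc (length (ys₁ ++ ys₂)) ≡ length (ys₁ ++ x ∷ ys₂)
    eq = trans (cong suc (length-++ ys₁))
               (trans (sym (+-suc (length ys₁) (length ys₂))) (sym (length-++ ys₁)))

  longer⇒∃∉ : DecidableEquality A → ∀ {xs ys : List A} → Unique xs → length ys < length xs →
              ∃ λ x → x ∈ xs × x ∉ ys
  longer⇒∃∉ _≟_ {xs} {ys} u ys<xs with all? (λ x → DecMembership._∈?_ _≟_ x ys) xs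
  ... | yes all = contradiction (unique-⊆⇒length≤ u (lookup all)) (<⇒≱ ys<xs)
  ... | no ¬all = find (¬All⇒Any¬ (λ x → DecMembership._∈?_ _≟_ x ys) xs ¬all)

  sum-map≤length* : ∀ (f : A → ℕ) m xs → (∀ {x} → x ∈ xs → f x ≤ m) →
                    sum (map f xs) ≤ length xs * m
  sum-map≤length* f m []       _ = z≤n
  sum-map≤length* f m (x ∷ xs) h = +-mono-≤ (h (here refl)) (sum-map≤length* f m xs (h ∘ there))

module _ {a b} {A : Set a} {B : Set b} (f : A → Maybe B) where

  ∈-mapMaybe⁺ : ∀ {x y xs} → x ∈ xs → f x ≡ just y → y ∈ mapMaybe f xs
  ∈-mapMaybe⁺ (here refl) eq rewrite eq = here refl
  ∈-mapMaybe⁺ {xs = x ∷ _} (there x∈) eq with f x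
  ... | just _  = there (∈-mapMaybe⁺ x∈ eq)
  ... | nothing = ∈-mapMaybe⁺ x∈ eq

  ∈-mapMaybe⁻ : ∀ {y} xs → y ∈ mapMaybe f xs → ∃ λ x → x ∈ xs × f x ≡ just y
  ∈-mapMaybe⁻ (x ∷ xs) y∈ with f x in eq | y∈
  ... | just _  | here refl = x , here refl , eq
  ... | just _  | there y∈′ with x′ , x′∈ , eq′ ← ∈-mapMaybe⁻ xs y∈′ = x′ , there x′∈ , eq′
  ... | nothing | y∈′       with x′ , x′∈ , eq′ ← ∈-mapMaybe⁻ xs y∈′ = x′ , there x′∈ , eq′

  mapMaybe-unique : (∀ {x x′ y} → f x ≡ just y → f x′ ≡ just y → x ≡ x′) →
                    ∀ {xs} → Unique xs → Unique (mapMaybe f xs)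
  mapMaybe-unique inj []                  = []
  mapMaybe-unique inj {x ∷ xs} (x∉ ∷ u) with f x in eq
  ... | nothing = mapMaybe-unique inj u
  ... | just y  = ∉⇒All≢ y∉ ∷ mapMaybe-unique inj u
    where
    y∉ : y ∉ mapMaybe f xs
    y∉ y∈ with x′ , x′∈ , eq′ ← ∈-mapMaybe⁻ xs y∈ = lookup x∉ x′∈ (inj eq eq′)

module PathProperties {c ℓ₁ ℓ₂} {W : WeightDomain c ℓ₁ ℓ₂} (G : Graph W) where
  open WeightDomain W using (isCommutativeMonoid; isTotalOrder; 0#)
    renaming (+-mono-≤ to +ʷ-mono-≤)
  open WeightDomain W public using () renaming (_≤_ to _≤ʷ_)
  open IsCommutativeMonoid isCommutativeMonoid using (identityʳ) renaming (sym to ≈-sym)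
  open IsTotalOrder isTotalOrder public
    using () renaming (refl to ≤ʷ-refl; reflexive to ≤ʷ-reflexive; trans to ≤ʷ-trans; total to ≤ʷ-total)
  open Graph G
  open Paths G

  weight-⊕ : ∀ {s v} (P : Path s v) u .(e : v ⟶ u) → weight P ≤ʷ weight (P ⊕ u , e)
  weight-⊕ {v = v} P u e =
    ≤ʷ-trans (≤ʷ-reflexive (≈-sym (identityʳ (weight P))))
             (+ʷ-mono-≤ ≤ʷ-refl (ω-nonNeg v u e))

  0≤weight : ∀ {s v} (P : Path s v) → 0# ≤ʷ weight P
  0≤weight trivial     = ≤ʷ-refl
  0≤weight (P ⊕ u , e) = ≤ʷ-trans (0≤weight P) (weight-⊕ P u e)

  source∈ : ∀ {s v} (P : Path s v) → s ∈ vertices P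
  source∈ trivial     = here refl
  source∈ (P ⊕ _ , _) = there (source∈ P)

  simple-loop : ∀ {s} (P : Path s s) → Simple P → P ≡ trivial
  simple-loop trivial     _ = refl
  simple-loop (P ⊕ _ , _) u = contradiction (source∈ P) (Unique[x∷xs]⇒x∉xs u)

  ⊕-injective : ∀ {s v u} {P Q : Path s v} .{e e′ : v ⟶ u} →
                _≡_ {A = Path s u} (P ⊕ u , e) (Q ⊕ u , e′) → P ≡ Q
  ⊕-injective refl = refl

  vertices-injective : ∀ {s v v′} (P : Path s v) (Q : Path s v′) → vertices P ≡ vertices Q →
                       _≡_ {A = ∃ (Path s)} (v , P) (v′ , Q)
  vertices-injective trivial               trivial               _  = refl
  vertices-injective trivial               (trivial ⊕ _ , _)     ()
  vertices-injective trivial               ((_ ⊕ _ , _) ⊕ _ , _) ()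
  vertices-injective (trivial ⊕ _ , _)     trivial               ()
  vertices-injective ((_ ⊕ _ , _) ⊕ _ , _) trivial               ()
  vertices-injective (P ⊕ u , _)           (Q ⊕ u′ , _)          eq
    with proj₁ (∷-injective eq) | vertices-injective P Q (proj₂ (∷-injective eq))
  ... | refl | refl = refl

  infix 4 _≟ₚ_
  _≟ₚ_ : ∀ {s t} → DecidableEquality (Path s t)
  P ≟ₚ Q = map′ (λ eq → same (vertices-injective P Q eq)) (cong vertices)
                (≡-dec _≟ᶠ_ (vertices P) (vertices Q))
    where
    same : ∀ {s t} {P Q : Path s t} → _≡_ {A = ∃ (Path s)} (t , P) (t , Q) → P ≡ Q
    same refl = refl

  length-vertices≤n : ∀ {s t} (P : Path s t) → Simple P → length (vertices P) ≤ n
  length-vertices≤n P u =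
    ≤-trans (unique-⊆⇒length≤ u (λ {x} _ → ∈-allFin x)) (≤-reflexive (length-tabulate {n = n} (λ i → i)))

  -- Listed from the source on, so that the part of a path still to be explored
  -- is consumed by structural recursion.
  infixr 5 _,_◃_
  data Route : V → V → Set where
    []    : ∀ {v} → Route v v
    _,_◃_ : ∀ {v w} u → .(v ⟶ u) → Route u w → Route v w

  stops : ∀ {v w} → Route v w → List V
  stops []          = []
  stops (u , _ ◃ R) = u ∷ stops R

  infixl 5 _▷_
  _▷_ : ∀ {s v w} → Path s v → Route v w → Path s w
  P ▷ []          = P
  P ▷ (u , e ◃ R) = (P ⊕ u , e) ▷ R

  unroll : ∀ {s v w} (P : Path s v) (R : Route v w) → ∃ λ R′ → trivial ▷ R′ ≡ P ▷ R
  unroll trivial     R = R , refl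
  unroll (P ⊕ u , e) R = unroll P (u , e ◃ R)

  ▷-injective : ∀ {s v w} (R : Route v w) {P Q : Path s v} → P ▷ R ≡ Q ▷ R → P ≡ Q
  ▷-injective []          eq = eq
  ▷-injective (u , e ◃ R) eq = ⊕-injective (▷-injective R eq)

  weight-▷ : ∀ {s v w} (P : Path s v) (R : Route v w) → weight P ≤ʷ weight (P ▷ R)
  weight-▷ P []          = ≤ʷ-refl
  weight-▷ P (u , e ◃ R) = ≤ʷ-trans (weight-⊕ P u e) (weight-▷ (P ⊕ u , e) R)

  weight-▷-mono : ∀ {s v w} {P Q : Path s v} (R : Route v w) →
                  weight P ≤ʷ weight Q → weight (P ▷ R) ≤ʷ weight (Q ▷ R)
  weight-▷-mono []          P≤Q = P≤Q
  weight-▷-mono (u , e ◃ R) P≤Q = weight-▷-mono R (+ʷ-mono-≤ P≤Q ≤ʷ-refl)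

  simple-prefix : ∀ {s v w} (P : Path s v) (R : Route v w) → Simple (P ▷ R) → Simple P
  simple-prefix P []          u = u
  simple-prefix P (x , e ◃ R) u with _ ∷ u′ ← simple-prefix (P ⊕ x , e) R u = u′

  simple⇒disjoint : ∀ {s v w} (P : Path s v) (R : Route v w) → Simple (P ▷ R) →
                    ∀ {z} → z ∈ vertices P → z ∉ stops R
  simple⇒disjoint P (x , e ◃ R) u z∈ (here refl) =
    Unique[x∷xs]⇒x∉xs (simple-prefix (P ⊕ x , e) R u) z∈
  simple⇒disjoint P (x , e ◃ R) u z∈ (there z∈R) =
    simple⇒disjoint (P ⊕ x , e) R u (there z∈) z∈R

  simple-graft : ∀ {s v w} (P Q : Path s v) (R : Route v w) → Simple (P ▷ R) → Simple Q →
                 (∀ {z} → z ∈ vertices Q → z ∉ stops R) → Simple (Q ▷ R)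
  simple-graft P Q []          _  uQ _    = uQ
  simple-graft P Q (x , e ◃ R) uP uQ disj =
    simple-graft (P ⊕ x , e) (Q ⊕ x , e) R uP
      (∉⇒All≢ (λ x∈Q → disj x∈Q (here refl)) ∷ uQ)
      λ { (here refl) → simple⇒disjoint (P ⊕ x , e) R uP (here refl)
        ; (there z∈)  → disj z∈ ∘ there }

  module _ (S : List V) where

    Avoids : ∀ {v w} → Route v w → Set
    Avoids R = ∀ {z} → z ∈ stops R → z ∉ S

    record LastVisit {s v w} (P : Path s v) (R : Route v w) : Set (c ⊔ ℓ₂) where
      field
        {last}  : V
        last≢s  : last ≢ s
        last∈S  : last ∈ S
        prefix  : Path s last
        suffix  : Route last w
        split   : prefix ▷ suffix ≡ P ▷ R
        avoids  : Avoids suffix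
        heavier : weight P ≤ʷ weight prefix
        shorter : length (stops suffix) ≤ length (stops R)

    avoids-or-visits : ∀ {s v w} (P : Path s v) (R : Route v w) → Simple (P ▷ R) →
                       Avoids R ⊎ LastVisit P R
    avoids-or-visits P []          _  = inj₁ λ ()
    avoids-or-visits P (u , e ◃ R) sP with avoids-or-visits (P ⊕ u , e) R sP
    ... | inj₂ L = inj₂ record
      { LastVisit L
      ; heavier = ≤ʷ-trans (weight-⊕ P u e) (LastVisit.heavier L)
      ; shorter = ≤-trans (LastVisit.shorter L) (n≤1+n _) }
    ... | inj₁ avoids with u ∈? S
    ...   | no u∉S  = inj₁ λ { (here refl) → u∉S ; (there z∈) → avoids z∈ }
    ...   | yes u∈S = inj₂ record
      { last≢s  = λ { refl → Unique[x∷xs]⇒x∉xs (simple-prefix (P ⊕ u , e) R sP) (source∈ P) }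
      ; last∈S  = u∈S
      ; prefix  = P ⊕ u , e
      ; suffix  = R
      ; split   = refl
      ; avoids  = avoids
      ; heavier = weight-⊕ P u e
      ; shorter = n≤1+n _ }

    last-visit : ∀ {s v w} (P : Path s v) (R : Route v w) → Simple (P ▷ R) → v ≢ s → v ∈ S →
                 LastVisit P R
    last-visit P R sP v≢s v∈S with avoids-or-visits P R sP
    ... | inj₂ L      = L
    ... | inj₁ avoids = record
      { last≢s = v≢s ; last∈S = v∈S ; prefix = P ; suffix = R ; split = refl
      ; avoids = avoids ; heavier = ≤ʷ-refl ; shorter = ≤-refl }

module Correctness {c ℓ₁ ℓ₂} {W : WeightDomain c ℓ₁ ℓ₂} (G : Graph W) (r : Graph.V G) (k : ℕ)
  where
  open Graph G
  open Paths G
  open PathProperties G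
  open PrunedSkSSP G r k

  ∈-V[] : ∀ {x} {Ps : List (Path r x)} {Q y} → Q ∈ Ps → y ∈ vertices Q → y ∈ V[ Ps ]
  ∈-V[] Q∈ y∈ = ∈-concatMap⁺ vertices (lose Q∈ y∈)

  extend-just⁻ : ∀ {v} (Π : Path r v) u {p} → extend Π u ≡ just p →
                 Σ (v ⟶ u) λ e → u ∉ vertices Π × p ≡ (u , (Π ⊕ u , e))
  extend-just⁻ {v} Π u eq with v ⟶? u | u ∈? vertices Π | eq
  ... | yes e | no u∉ | refl = e , u∉ , refl

  extend-just⁺ : ∀ {v} (Π : Path r v) u .(e : v ⟶ u) → u ∉ vertices Π →
                 extend Π u ≡ just (u , (Π ⊕ u , e))
  extend-just⁺ {v} Π u e u∉ with v ⟶? u | u ∈? vertices Π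
  ... | yes _ | no _   = refl
  ... | yes _ | yes u∈ = contradiction u∈ u∉
  ... | no ¬e | _      = ⊥-elim-irr (¬e e)

  data IsExtension {v} (Π : Path r v) : ∃ (Path r) → Set where
    extension : ∀ {u} (e : v ⟶ u) → u ∉ vertices Π → IsExtension Π (u , (Π ⊕ u , e))

  ∈-extensions⁻ : ∀ {v} (Π : Path r v) {p} → p ∈ extensions Π → IsExtension Π p
  ∈-extensions⁻ Π p∈ with u , _ , eq ← ∈-mapMaybe⁻ (extend Π) (allFin n) p∈
                     with e , u∉ , refl ← extend-just⁻ Π u eq = extension e u∉

  ∈-extensions⁺ : ∀ {v} (Π : Path r v) u .(e : v ⟶ u) → u ∉ vertices Π →
                  (u , (Π ⊕ u , e)) ∈ extensions Π
  ∈-extensions⁺ Π u e u∉ = ∈-mapMaybe⁺ (extend Π) (∈-allFin u) (extend-just⁺ Π u e u∉)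

  extensions-unique : ∀ {v} (Π : Path r v) → Unique (extensions Π)
  extensions-unique Π = mapMaybe-unique (extend Π) same-head (allFin⁺ n)
    where
    same-head : ∀ {u u′ p} → extend Π u ≡ just p → extend Π u′ ≡ just p → u ≡ u′
    same-head {u} {u′} eq eq′ with _ , _ , p≡ ← extend-just⁻ Π u eq
                              with _ , _ , p≡′ ← extend-just⁻ Π u′ eq′
                              = trans (sym (cong proj₁ p≡)) (cong proj₁ p≡′)

  data Added {v} (Π : Path r v) (T : Lists) : (w : V) → List (Path r w) → Set where
    kept     : ∀ {w} → v ≢ w ⊎ k ≤ length (T w) → Added Π T w (T w)
    appended : length (T v) < k → Added Π T v (T v ++ [ Π ])

  added : ∀ {v} (Π : Path r v) T w → Added Π T w (add Π T w)
  added {v} Π T w with v ≟ᶠ w | length (T w) <? k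
  ... | yes refl | yes <k = appended <k
  ... | yes refl | no ≮k  = kept (inj₂ (≮⇒≥ ≮k))
  ... | no v≢w   | yes _  = kept (inj₁ v≢w)
  ... | no v≢w   | no _   = kept (inj₁ v≢w)

  module _ {v} (Π : Path r v) (T : Lists) where

    add-saturated : ∀ {w} → k ≤ length (T w) → add Π T w ≡ T w
    add-saturated {w} k≤ with add Π T w | added Π T w
    ... | _ | kept _      = refl
    ... | _ | appended <k = contradiction k≤ (<⇒≱ <k)

    ∈-add⁺ : ∀ {w Q} → Q ∈ T w → Q ∈ add Π T w
    ∈-add⁺ {w} Q∈ with add Π T w | added Π T w
    ... | _ | kept _     = Q∈
    ... | _ | appended _ = ∈-++⁺ˡ Q∈

    ∈-add⁻ : ∀ {w Q} → Q ∈ add Π T w →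
             Q ∈ T w ⊎ ((w , Q) ≡ (v , Π) × length (T v) < k)
    ∈-add⁻ {w} Q∈ with add Π T w | added Π T w
    ... | _ | kept _      = inj₁ Q∈
    ... | _ | appended <k with ∈-++⁻ (T v) Q∈
    ...   | inj₁ Q∈T         = inj₁ Q∈T
    ...   | inj₂ (here refl) = inj₂ (refl , <k)

    length-add≥ : ∀ {w} → length (T w) ≤ length (add Π T w)
    length-add≥ {w} with add Π T w | added Π T w
    ... | _ | kept _     = ≤-refl
    ... | _ | appended _ = ≤-trans (m≤m+n _ 1) (≤-reflexive (sym (length-++ (T v))))

    length-add≤ : ∀ {w} → length (T w) ≤ k → length (add Π T w) ≤ k
    length-add≤ {w} ≤k with add Π T w | added Π T w
    ... | _ | kept _      = ≤k
    ... | _ | appended <k =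
      ≤-trans (≤-reflexive (trans (length-++ (T v)) (+-comm (length (T v)) 1))) <k

    add-listed : Π ∈ add Π T v ⊎ k ≤ length (add Π T v)
    add-listed with add Π T v | added Π T v
    ... | _ | kept (inj₁ v≢v) = contradiction refl v≢v
    ... | _ | kept (inj₂ k≤)  = inj₂ k≤
    ... | _ | appended _      = inj₁ (∈-++⁺ʳ (T v) (here refl))

    add-unique : Π ∉ T v → ∀ {w} → Unique (T w) → Unique (add Π T w)
    add-unique Π∉ {w} u with add Π T w | added Π T w
    ... | _ | kept _     = u
    ... | _ | appended _ =
      Uniqueₚ.++⁺ u ([] ∷ []) λ { (x∈ , here refl) → Π∉ x∈ }

  module _ (T : Lists) (v : V) where

    unsaturated? : ∀ x → Dec (Unsaturated T v x)
    unsaturated? x = (length (T x) <? k) ×-dec (¬? (x ≟ᶠ r) ⊎-dec (x ≟ᶠ v))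

    Processed : List V → V → Set
    Processed S x = ¬ Unsaturated T v x × (∀ {y} → y ∈ V[ T x ] → y ∈ S)

    Fresh? : ∀ x seen u → Dec (u ∉ seen × u ∈ V[ T x ])
    Fresh? x seen u = ¬? (u ∈? seen) ×-dec (u ∈? V[ T x ])

    loop-sound : ∀ {Q seen} → PruningLoop T v Q seen true →
                 (∀ {x} → x ∈ seen → x ∈ Q ⊎ Processed seen x) →
                 ∃ λ S → (∀ {x} → x ∈ seen → x ∈ S) × (∀ {x} → x ∈ S → Processed S x)
    loop-sound {seen = seen} exhausted inv = seen , (λ x∈ → x∈) , processed
      where
      processed : ∀ {x} → x ∈ seen → Processed seen x
      processed x∈ with inv x∈
      ... | inj₂ p = p
    loop-sound {x ∷ Q} {seen} (next sat loop) inv =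
      let S , seen⊆S , closed = loop-sound loop inv′ in S , seen⊆S ∘ ∈-++⁺ˡ , closed
      where
      new = unseen T x seen
      reached : ∀ {y} → y ∈ V[ T x ] → y ∈ seen ++ new
      reached {y} y∈ with y ∈? seen
      ... | yes y∈seen = ∈-++⁺ˡ y∈seen
      ... | no y∉seen  = ∈-++⁺ʳ seen (∈-filter⁺ (Fresh? x seen) (∈-allFin y) (y∉seen , y∈))
      inv′ : ∀ {y} → y ∈ seen ++ new → y ∈ Q ++ new ⊎ Processed (seen ++ new) y
      inv′ y∈ with ∈-++⁻ seen y∈
      ... | inj₂ y∈new = inj₁ (∈-++⁺ʳ Q y∈new)
      ... | inj₁ y∈seen with inv y∈seen
      ...   | inj₁ (here refl)   = inj₂ (sat , reached)
      ...   | inj₁ (there y∈Q)   = inj₁ (∈-++⁺ˡ y∈Q)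
      ...   | inj₂ (sat′ , ⊆seen) = inj₂ (sat′ , ∈-++⁺ˡ ∘ ⊆seen)

    pruning-sound : Pruning T v true →
                    ∃ λ S → v ∈ S × (∀ {x} → x ∈ S → Processed S x)
    pruning-sound loop =
      let S , v∈S , closed = loop-sound loop inj₁ in S , v∈S (here refl) , closed

    loop-total : ∀ Q seen → Unique seen → Acc _<_ (length Q + (n ∸ length seen)) →
                 ∃ (PruningLoop T v Q seen)
    loop-total []      seen _ _ = true , exhausted
    loop-total (x ∷ Q) seen u (acc rec) with unsaturated? x
    ... | yes unsat = false , unsaturated unsat
    ... | no sat    =
      let b , loop = loop-total (Q ++ new) (seen ++ new) u′ (rec (s≤s decrease)) in
      b , next sat loop
      where
      new = unseen T x seen
      u′ : Unique (seen ++ new)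
      u′ = Uniqueₚ.++⁺ u (Uniqueₚ.filter⁺ (Fresh? x seen) (allFin⁺ n))
             λ { (y∈seen , y∈new) →
                 proj₁ (proj₂ (∈-filter⁻ (Fresh? x seen) {xs = allFin n} y∈new)) y∈seen }
      bound : length seen + length new ≤ n
      bound = ≤-trans (≤-reflexive (sym (length-++ seen)))
             (≤-trans (unique-⊆⇒length≤ u′ (λ {y} _ → ∈-allFin y))
                      (≤-reflexive (length-tabulate {n = n} (λ i → i))))
      decrease : length (Q ++ new) + (n ∸ length (seen ++ new)) ≤ length Q + (n ∸ length seen)
      decrease = ≤-reflexive (begin
        length (Q ++ new) + (n ∸ length (seen ++ new))
          ≡⟨ cong₂ (λ a b → a + (n ∸ b)) (length-++ Q) (length-++ seen) ⟩
        length Q + length new + (n ∸ (length seen + length new))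
          ≡⟨ +-assoc (length Q) _ _ ⟩
        length Q + (length new + (n ∸ (length seen + length new)))
          ≡⟨ cong (λ a → length Q + (length new + a)) (sym (∸-+-assoc n (length seen) _)) ⟩
        length Q + (length new + (n ∸ length seen ∸ length new))
          ≡⟨ cong (length Q +_) (m+[n∸m]≡n
               (m+n≤o⇒m≤o∸n (length new)
                 (≤-trans (≤-reflexive (+-comm (length new) _)) bound))) ⟩
        length Q + (n ∸ length seen) ∎)
        where open ≡-Reasoning

    pruning-total : ∃ (Pruning T v)
    pruning-total = loop-total [ v ] [ v ] ([] ∷ []) (<-wellFounded _)

  Key≤ : ∃ (Path r) → ∃ (Path r) → Set ℓ₂
  Key≤ p q = weight (proj₂ p) ≤ʷ weight (proj₂ q)

  extract-min : ∀ p ps → ∃ λ m → ∃ λ rest → (p ∷ ps) ↭ m ∷ rest × All (Key≤ m) rest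
  extract-min p []       = p , [] , ↭-refl , []
  extract-min p (q ∷ qs) with m , rest , σ , m≤ ← extract-min q qs
                         with ≤ʷ-total (weight (proj₂ p)) (weight (proj₂ m))
  ... | inj₁ p≤m = p , m ∷ rest , prep p σ , p≤m ∷ All.map (≤ʷ-trans p≤m) m≤
  ... | inj₂ m≤p = m , p ∷ rest , ↭-trans (prep p σ) (swap p m ↭-refl) , m≤p ∷ m≤

  guard⇒step : ∀ s → Guard s → ∃ (Step s)
  guard⇒step ⟨ [] , T ⟩     (PQ≢[] , _) = contradiction refl PQ≢[]
  guard⇒step ⟨ p ∷ ps , T ⟩ guard
    with m , rest , σ , m≤ ← extract-min p ps
    with _ , loop ← pruning-total T (proj₁ m) = _ , step guard σ m≤ loop

  extension-simple : ∀ {v} {Π : Path r v} → Simple Π → ∀ {p} → IsExtension Π p → Simple (proj₂ p)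
  extension-simple sΠ (extension e u∉) = ∉⇒All≢ u∉ ∷ sΠ

  -- cost d bounds the number of paths removed from the queue on behalf of a
  -- path that can be extended fewer than d times.
  cost : ℕ → ℕ
  cost zero    = 0
  cost (suc d) = suc (n * cost d)

  pathCost : ∃ (Path r) → ℕ
  pathCost (_ , P) = cost (suc n ∸ length (vertices P))

  queueCost : List (∃ (Path r)) → ℕ
  queueCost = sum ∘ map pathCost

  extensions-cost : ∀ {v} (Π : Path r v) → Simple Π → queueCost (extensions Π) < pathCost (v , Π)
  extensions-cost {v} Π sΠ = begin
    suc (queueCost (extensions Π))
      ≤⟨ s≤s (sum-map≤length* pathCost d (extensions Π) (each ∘ ∈-extensions⁻ Π)) ⟩
    suc (length (extensions Π) * d)
      ≤⟨ s≤s (*-monoˡ-≤ d (length-mapMaybe (extend Π) (allFin n))) ⟩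
    suc (length (allFin n) * d)
      ≡⟨ cong (λ a → suc (a * d)) (length-tabulate {n = n} (λ i → i)) ⟩
    cost (suc (n ∸ length (vertices Π)))
      ≡⟨ cong cost (sym (+-∸-assoc 1 (length-vertices≤n Π sΠ))) ⟩
    pathCost (v , Π) ∎
    where
    open ≤-Reasoning
    d = cost (n ∸ length (vertices Π))
    each : ∀ {p} → IsExtension Π p → pathCost p ≤ d
    each (extension _ _) = ≤-refl

  simple-queue⇒acc : ∀ s → All (Simple ∘ proj₂) (queue s) → Acc _<_ (queueCost (queue s)) →
                     Acc (flip Step) s
  simple-queue⇒acc s simple (acc rec) = acc λ st → next-acc st simple rec
    where
    next-acc : ∀ {s t} → Step s t → All (Simple ∘ proj₂) (queue s) →
               (∀ {m} → m < queueCost (queue s) → Acc _<_ m) → Acc (flip Step) t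
    next-acc (step {Π = Π} {rest} {b} _ σ _ _) simple rec
      with sΠ ∷ srest ← All-resp-↭ σ simple
      = simple-queue⇒acc _ (simple′ b) (rec (<-≤-trans (decrease b) (≤-reflexive cost-σ)))
      where
      cost-σ : queueCost ((_ , Π) ∷ rest) ≡ _
      cost-σ = sym (sum-↭ (map⁺ pathCost σ))
      simple′ : ∀ b → All (Simple ∘ proj₂) (if b then rest else extensions Π ++ rest)
      simple′ true  = srest
      simple′ false = Allₚ.++⁺ (tabulate (extension-simple sΠ ∘ ∈-extensions⁻ Π)) srest
      decrease : ∀ b → queueCost (if b then rest else extensions Π ++ rest)
                       < queueCost ((_ , Π) ∷ rest)
      decrease true  = +-monoˡ-≤ _ (≤-trans (s≤s z≤n) (extensions-cost Π sΠ))
      decrease false = ≤-trans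
        (≤-reflexive (cong suc (trans (cong sum (map-++ pathCost (extensions Π) rest))
                                      (sum-++ (map pathCost (extensions Π)) _))))
        (+-monoˡ-≤ _ (extensions-cost Π sΠ))

  -- The part of the justification for pruning P that stays true in all later
  -- states; r is exempt because its list never reaches length k when k > 1.
  record Blocked (T : Lists) {u} (P : Path r u) : Set ℓ₂ where
    field
      region    : List V
      endpoint  : u ∈ region
      saturated : ∀ {x} → x ∈ region → x ≢ r → k ≤ length (T x)
      closed    : ∀ {x} → x ∈ region → x ≢ r → ∀ {Q y} → Q ∈ T x → y ∈ vertices Q → y ∈ region
      lighter   : ∀ {x} → x ∈ region → x ≢ r → ∀ {Q} → Q ∈ T x → weight Q ≤ʷ weight P

  Blocked-add : ∀ {v T} (Π : Path r v) {u} {P : Path r u} → Blocked T P → Blocked (add Π T) P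
  Blocked-add {T = T} Π B = record
    { region    = region
    ; endpoint  = endpoint
    ; saturated = λ x∈ x≢r → ≤-trans (saturated x∈ x≢r) (length-add≥ Π T)
    ; closed    = λ x∈ x≢r → closed x∈ x≢r ∘ old x∈ x≢r
    ; lighter   = λ x∈ x≢r → lighter x∈ x≢r ∘ old x∈ x≢r
    }
    where
    open Blocked B
    old : ∀ {x} → x ∈ region → x ≢ r → ∀ {Q} → Q ∈ add Π T x → Q ∈ T x
    old x∈ x≢r {Q} = subst (Q ∈_) (add-saturated Π T (saturated x∈ x≢r))

  ParentIn : List (∃ (Path r)) → ∃ (Path r) → Set
  ParentIn X (_ , trivial)             = ⊤
  ParentIn X (_ , (_⊕_,_ {v} P _ _)) = (v , P) ∈ X

  ParentIn-⊆ : ∀ {X Y} → (∀ {q} → q ∈ X → q ∈ Y) → ∀ {p} → ParentIn X p → ParentIn Y p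
  ParentIn-⊆ X⊆Y {_ , trivial}   _  = _
  ParentIn-⊆ X⊆Y {_ , _ ⊕ _ , _} p∈ = X⊆Y p∈

  data Discovered (s : State) (X : List (∃ (Path r))) {u} (P : Path r u) : Set ℓ₂ where
    queued   : (u , P) ∈ queue s → Discovered s X P
    expanded : (u , P) ∈ X → Discovered s X P
    blocked  : Blocked (lists s) P → Discovered s X P

  -- X collects the paths whose extensions have been inserted into the queue.
  record Invariant (s : State) (X : List (∃ (Path r))) : Set ℓ₂ where
    field
      queue-simple    : ∀ {p} → p ∈ queue s → Simple (proj₂ p)
      queue-unique    : Unique (queue s)
      queue-fresh     : ∀ {p} → p ∈ queue s → p ∉ X
      queue-parent    : ∀ {p} → p ∈ queue s → ParentIn X p
      expanded-simple : ∀ {p} → p ∈ X → Simple (proj₂ p)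
      expanded-parent : ∀ {p} → p ∈ X → ParentIn X p
      expanded-listed : ∀ {v P} → (v , P) ∈ X → P ∈ lists s v ⊎ k ≤ length (lists s v)
      expanded-child  : ∀ {v P} → (v , P) ∈ X → ∀ u .(e : v ⟶ u) → Simple (P ⊕ u , e) →
                        Discovered s X (P ⊕ u , e)
      root            : (r , trivial) ∈ queue s ⊎ (r , trivial) ∈ X
      listed-expanded : ∀ {v P} → P ∈ lists s v → (v , P) ∈ X
      listed-unique   : ∀ v → Unique (lists s v)
      listed-≤k       : ∀ v → length (lists s v) ≤ k
      listed-≤queue   : ∀ {v P p} → P ∈ lists s v → p ∈ queue s → weight P ≤ʷ weight (proj₂ p)
      listed-optimal  : ∀ {v} → k ≤ length (lists s v) → ∀ P → Simple P → P ∉ lists s v →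
                        ∀ {Q} → Q ∈ lists s v → weight Q ≤ʷ weight P

  initial-invariant : k > 0 → Invariant initial []
  initial-invariant k>0 = record
    { queue-simple    = λ { (here refl) → [] ∷ [] }
    ; queue-unique    = [] ∷ []
    ; queue-fresh     = λ _ ()
    ; queue-parent    = λ { (here refl) → _ }
    ; expanded-simple = λ ()
    ; expanded-parent = λ ()
    ; expanded-listed = λ ()
    ; expanded-child  = λ ()
    ; root            = inj₁ (here refl)
    ; listed-expanded = λ ()
    ; listed-unique   = λ _ → []
    ; listed-≤k       = λ _ → z≤n
    ; listed-≤queue   = λ ()
    ; listed-optimal  = λ _ _ _ _ ()
    }

  module Invariants {s X} (inv : Invariant s X) where
    open Invariant inv

    T : Lists
    T = lists s

    _QueuedBelow : ∀ {w} → Path r w → Set ℓ₂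
    P QueuedBelow = ∃ λ p → p ∈ queue s × weight (proj₂ p) ≤ʷ weight P

    expanded⇒queuedBelow : ∀ {v w} {P : Path r v} (R : Route v w) → Acc _<_ (length (stops R)) →
                           length (T w) < k → (v , P) ∈ X → Simple (P ▷ R) → P ▷ R ∉ T w →
                           (P ▷ R) QueuedBelow
    expanded⇒queuedBelow [] _ <k P∈X _ P∉T with expanded-listed P∈X
    ... | inj₁ P∈T = contradiction P∈T P∉T
    ... | inj₂ k≤  = contradiction k≤ (<⇒≱ <k)
    expanded⇒queuedBelow {w = w} {P} (u , e ◃ R) (acc rec) <k P∈X sPR PR∉T
      with expanded-child P∈X u e (simple-prefix (P ⊕ u , e) R sPR)
    ... | queued Pu∈   = _ , Pu∈ , weight-▷ (P ⊕ u , e) R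
    ... | expanded Pu∈ = expanded⇒queuedBelow R (rec ≤-refl) <k Pu∈ sPR PR∉T
    ... | blocked B    =
      let p , p∈ , p≤ = expanded⇒queuedBelow suffix (rec (s≤s shorter)) <k (listed-expanded Q∈)
                          (simple-graft prefix Q suffix (subst Simple (sym split) sPR)
                            (expanded-simple (listed-expanded Q∈))
                            (λ z∈Q z∈R → avoids z∈R (closed last∈S last≢s Q∈ z∈Q)))
                          QR∉
      in p , p∈ , ≤ʷ-trans p≤ (subst (λ P′ → weight (Q ▷ suffix) ≤ʷ weight P′) split
                    (weight-▷-mono suffix (≤ʷ-trans (lighter last∈S last≢s Q∈) heavier)))
      where
      open Blocked B
      u≢r : u ≢ r
      u≢r refl = Unique[x∷xs]⇒x∉xs (simple-prefix (P ⊕ u , e) R sPR) (source∈ P)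
      open LastVisit (last-visit region (P ⊕ u , e) R sPR u≢r endpoint)
      replacements : List (Path r w)
      replacements = map (_▷ suffix) (T last)
      unlisted : ∃ λ Q → Q ∈ T last × Q ▷ suffix ∉ T w
      unlisted
        with P′ , P′∈ , P′∉ ← longer⇒∃∉ _≟ₚ_ {replacements} {T w}
               (Uniqueₚ.map⁺ (▷-injective suffix) (listed-unique last))
               (<-≤-trans <k (≤-trans (saturated last∈S last≢s)
                                      (≤-reflexive (sym (length-map _ (T last))))))
        with Q , Q∈ , refl ← ∈-map⁻ (_▷ suffix) P′∈ = Q , Q∈ , P′∉
      Q   = proj₁ unlisted
      Q∈  = proj₁ (proj₂ unlisted)
      QR∉ = proj₂ (proj₂ unlisted)

    unlisted⇒queuedBelow : ∀ {w} → length (T w) < k → (P : Path r w) → Simple P → P ∉ T w →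
                           P QueuedBelow
    unlisted⇒queuedBelow <k P sP P∉ with root
    ... | inj₁ triv∈ = _ , triv∈ , 0≤weight P
    ... | inj₂ triv∈ with R , refl ← unroll P [] =
      expanded⇒queuedBelow R (<-wellFounded _) <k triv∈ sP P∉

    root-unsaturated : k > 0 → (r , trivial) ∈ queue s → ¬ k ≤ length (T r)
    root-unsaturated k>0 triv∈ k≤ with T r in eq
    ... | []    = contradiction k≤ (<⇒≱ k>0)
    ... | Q ∷ _ = queue-fresh triv∈
      (subst (λ P → (r , P) ∈ X) (simple-loop Q (expanded-simple Q∈X)) Q∈X)
      where Q∈X = listed-expanded (subst (Q ∈_) (sym eq) (here refl))

  module Preservation (k>0 : k > 0) {PQ T X v rest} {Π : Path r v}
    (inv : Invariant ⟨ PQ , T ⟩ X)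
    (σ   : PQ ↭ (v , Π) ∷ rest)
    (min : All (λ p → weight Π ≤ʷ weight (proj₂ p)) rest)
    where
    open Invariant inv
    open Invariants inv using (unlisted⇒queuedBelow; root-unsaturated)

    T′ : Lists
    T′ = add Π T

    Π∈ : (v , Π) ∈ PQ
    Π∈ = ∈-resp-↭ (↭-sym σ) (here refl)

    rest⊆ : ∀ {p} → p ∈ rest → p ∈ PQ
    rest⊆ = ∈-resp-↭ (↭-sym σ) ∘ there

    sΠ : Simple Π
    sΠ = queue-simple Π∈

    Π∷rest-unique : Unique ((v , Π) ∷ rest)
    Π∷rest-unique = Unique-resp-↭ σ queue-unique

    rest-unique : Unique rest
    rest-unique with _ ∷ u ← Π∷rest-unique = u

    Π∉rest : (v , Π) ∉ rest
    Π∉rest = Unique[x∷xs]⇒x∉xs Π∷rest-unique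

    split-queue : ∀ {p} → p ∈ PQ → p ≡ (v , Π) ⊎ p ∈ rest
    split-queue p∈ with ∈-resp-↭ σ p∈
    ... | here eq   = inj₁ eq
    ... | there p∈′ = inj₂ p∈′

    Π-min : ∀ {p} → p ∈ PQ → weight Π ≤ʷ weight (proj₂ p)
    Π-min p∈ with split-queue p∈
    ... | inj₁ refl = ≤ʷ-refl
    ... | inj₂ p∈′  = lookup min p∈′

    listed-unique′ : ∀ w → Unique (T′ w)
    listed-unique′ w = add-unique Π T (queue-fresh Π∈ ∘ listed-expanded) (listed-unique w)

    listed-≤k′ : ∀ w → length (T′ w) ≤ k
    listed-≤k′ w = length-add≤ Π T (listed-≤k w)

    listed-≤Π : ∀ {w Q} → Q ∈ T′ w → weight Q ≤ʷ weight Π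
    listed-≤Π Q∈ with ∈-add⁻ Π T Q∈
    ... | inj₁ Q∈T        = listed-≤queue Q∈T Π∈
    ... | inj₂ (refl , _) = ≤ʷ-refl

    listed-optimal′ : ∀ {w} → k ≤ length (T′ w) → ∀ P → Simple P → P ∉ T′ w →
                      ∀ {Q} → Q ∈ T′ w → weight Q ≤ʷ weight P
    listed-optimal′ {w} _ P sP P∉ {Q} Q∈ = by-cases (length (T w) <? k)
      where
      by-cases : Dec (length (T w) < k) → weight Q ≤ʷ weight P
      by-cases (no ≮k)  = listed-optimal k≤ P sP (P∉ ∘ ∈-add⁺ Π T)
                            (subst (Q ∈_) (add-saturated Π T k≤) Q∈)
        where k≤ = ≮⇒≥ ≮k
      by-cases (yes <k) with _ , p∈ , p≤ ← unlisted⇒queuedBelow <k P sP (P∉ ∘ ∈-add⁺ Π T) =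
        ≤ʷ-trans (listed-≤Π Q∈) (≤ʷ-trans (Π-min p∈) p≤)

    expanded-listed′ : ∀ {w P} → (w , P) ∈ X → P ∈ T′ w ⊎ k ≤ length (T′ w)
    expanded-listed′ P∈ with expanded-listed P∈
    ... | inj₁ P∈T = inj₁ (∈-add⁺ Π T P∈T)
    ... | inj₂ k≤  = inj₂ (≤-trans k≤ (length-add≥ Π T))

    expand : Invariant ⟨ extensions Π ++ rest , T′ ⟩ ((v , Π) ∷ X)
    expand = record
      { queue-simple    = queue-simple′
      ; queue-unique    = Uniqueₚ.++⁺ (extensions-unique Π) rest-unique
                            λ { (p∈ext , p∈rest) → extension∉rest (∈-extensions⁻ Π p∈ext) p∈rest }
      ; queue-fresh     = queue-fresh′
      ; queue-parent    = queue-parent′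
      ; expanded-simple = λ { (here refl) → sΠ ; (there p∈) → expanded-simple p∈ }
      ; expanded-parent = λ { {p} (here refl) → ParentIn-⊆ there {p} (queue-parent Π∈)
                            ; {p} (there p∈)  → ParentIn-⊆ there {p} (expanded-parent p∈) }
      ; expanded-listed = λ { (here refl) → add-listed Π T ; (there p∈) → expanded-listed′ p∈ }
      ; expanded-child  = expanded-child′
      ; root            = root′
      ; listed-expanded = listed-expanded′
      ; listed-unique   = listed-unique′
      ; listed-≤k       = listed-≤k′
      ; listed-≤queue   = λ Q∈ p∈ → ≤ʷ-trans (listed-≤Π Q∈) (Π≤queue′ p∈)
      ; listed-optimal  = listed-optimal′
      }
      where
      PQ′ = extensions Π ++ rest
      X′ = (v , Π) ∷ X

      extension∉rest : ∀ {p} → IsExtension Π p → p ∉ rest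
      extension∉rest (extension _ _) p∈ = queue-fresh Π∈ (queue-parent (rest⊆ p∈))

      extension∉X′ : ∀ {p} → IsExtension Π p → p ∉ X′
      extension∉X′ (extension _ _) (there p∈) = queue-fresh Π∈ (expanded-parent p∈)

      split-queue′ : ∀ {p} → p ∈ PQ′ → IsExtension Π p ⊎ p ∈ rest
      split-queue′ p∈ with ∈-++⁻ (extensions Π) p∈
      ... | inj₁ p∈ext  = inj₁ (∈-extensions⁻ Π p∈ext)
      ... | inj₂ p∈rest = inj₂ p∈rest

      queue-simple′ : ∀ {p} → p ∈ PQ′ → Simple (proj₂ p)
      queue-simple′ p∈ with split-queue′ p∈
      ... | inj₁ ext    = extension-simple sΠ ext
      ... | inj₂ p∈rest = queue-simple (rest⊆ p∈rest)

      queue-fresh′ : ∀ {p} → p ∈ PQ′ → p ∉ X′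
      queue-fresh′ p∈ with split-queue′ p∈
      ... | inj₁ ext    = extension∉X′ ext
      ... | inj₂ p∈rest = λ { (here refl) → Π∉rest p∈rest
                            ; (there p∈X) → queue-fresh (rest⊆ p∈rest) p∈X }

      queue-parent′ : ∀ {p} → p ∈ PQ′ → ParentIn X′ p
      queue-parent′ {p} p∈ with split-queue′ p∈
      ... | inj₁ (extension _ _) = here refl
      ... | inj₂ p∈rest          = ParentIn-⊆ there {p} (queue-parent (rest⊆ p∈rest))

      Π≤queue′ : ∀ {p} → p ∈ PQ′ → weight Π ≤ʷ weight (proj₂ p)
      Π≤queue′ p∈ with split-queue′ p∈
      ... | inj₁ (extension {u} e _) = weight-⊕ Π u e
      ... | inj₂ p∈rest              = lookup min p∈rest

      expanded-child′ : ∀ {x P} → (x , P) ∈ X′ → ∀ u .(e : x ⟶ u) → Simple (P ⊕ u , e) →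
                        Discovered ⟨ PQ′ , T′ ⟩ X′ (P ⊕ u , e)
      expanded-child′ (here refl) u e sP =
        queued (∈-++⁺ˡ (∈-extensions⁺ Π u e (Unique[x∷xs]⇒x∉xs sP)))
      expanded-child′ (there P∈) u e sP with expanded-child P∈ u e sP
      ... | expanded Pu∈ = expanded (there Pu∈)
      ... | blocked B    = blocked (Blocked-add Π B)
      ... | queued Pu∈ with split-queue Pu∈
      ...   | inj₁ refl    = expanded (here refl)
      ...   | inj₂ Pu∈rest = queued (∈-++⁺ʳ (extensions Π) Pu∈rest)

      root′ : (r , trivial) ∈ PQ′ ⊎ (r , trivial) ∈ X′
      root′ with root
      ... | inj₂ triv∈X = inj₂ (there triv∈X)
      ... | inj₁ triv∈ with split-queue triv∈
      ...   | inj₁ refl      = inj₂ (here refl)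
      ...   | inj₂ triv∈rest = inj₁ (∈-++⁺ʳ (extensions Π) triv∈rest)

      listed-expanded′ : ∀ {w Q} → Q ∈ T′ w → (w , Q) ∈ X′
      listed-expanded′ Q∈ with ∈-add⁻ Π T Q∈
      ... | inj₁ Q∈T        = there (listed-expanded Q∈T)
      ... | inj₂ (refl , _) = here refl

    prune : Pruning T v true → Invariant ⟨ rest , T′ ⟩ X
    prune loop = record
      { queue-simple    = queue-simple ∘ rest⊆
      ; queue-unique    = rest-unique
      ; queue-fresh     = queue-fresh ∘ rest⊆
      ; queue-parent    = queue-parent ∘ rest⊆
      ; expanded-simple = expanded-simple
      ; expanded-parent = expanded-parent
      ; expanded-listed = expanded-listed′
      ; expanded-child  = expanded-child′
      ; root            = root′
      ; listed-expanded = listed-expanded′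
      ; listed-unique   = listed-unique′
      ; listed-≤k       = listed-≤k′
      ; listed-≤queue   = λ Q∈ p∈ → ≤ʷ-trans (listed-≤Π Q∈) (lookup min p∈)
      ; listed-optimal  = listed-optimal′
      }
      where
      S = proj₁ (pruning-sound T v loop)
      v∈S = proj₁ (proj₂ (pruning-sound T v loop))
      S-closed = proj₂ (proj₂ (pruning-sound T v loop))

      v-saturated : k ≤ length (T v)
      v-saturated = ≮⇒≥ λ <k → proj₁ (S-closed v∈S) (<k , inj₂ refl)

      Π-blocked : Blocked T Π
      Π-blocked = record
        { region    = S
        ; endpoint  = v∈S
        ; saturated = λ x∈ x≢r → ≮⇒≥ λ <k → proj₁ (S-closed x∈) (<k , inj₁ x≢r)
        ; closed    = λ x∈ _ Q∈ y∈ → proj₂ (S-closed x∈) (∈-V[] Q∈ y∈)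
        ; lighter   = λ _ _ Q∈ → listed-≤queue Q∈ Π∈
        }

      expanded-child′ : ∀ {x P} → (x , P) ∈ X → ∀ u .(e : x ⟶ u) → Simple (P ⊕ u , e) →
                        Discovered ⟨ rest , T′ ⟩ X (P ⊕ u , e)
      expanded-child′ P∈ u e sP with expanded-child P∈ u e sP
      ... | expanded Pu∈ = expanded Pu∈
      ... | blocked B    = blocked (Blocked-add Π B)
      ... | queued Pu∈ with split-queue Pu∈
      ...   | inj₁ refl    = blocked (Blocked-add Π Π-blocked)
      ...   | inj₂ Pu∈rest = queued Pu∈rest

      root′ : (r , trivial) ∈ rest ⊎ (r , trivial) ∈ X
      root′ with root
      ... | inj₂ triv∈X = inj₂ triv∈X
      ... | inj₁ triv∈ with split-queue triv∈
      ...   | inj₁ refl      = contradiction v-saturated (root-unsaturated k>0 triv∈)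
      ...   | inj₂ triv∈rest = inj₁ triv∈rest

      listed-expanded′ : ∀ {w Q} → Q ∈ T′ w → (w , Q) ∈ X
      listed-expanded′ Q∈ with ∈-add⁻ Π T Q∈
      ... | inj₁ Q∈T      = listed-expanded Q∈T
      ... | inj₂ (_ , <k) = contradiction v-saturated (<⇒≱ <k)

  step-invariant : k > 0 → ∀ {s t X} → Step s t → Invariant s X → ∃ (Invariant t)
  step-invariant k>0 (step {b = true}  _ σ min loop) inv = _ , Preservation.prune k>0 inv σ min loop
  step-invariant k>0 (step {b = false} _ σ min _)    inv = _ , Preservation.expand k>0 inv σ min

  star-invariant : k > 0 → ∀ {s t X} → Star Step s t → Invariant s X → ∃ (Invariant t)
  star-invariant k>0 ε         inv = _ , inv
  star-invariant k>0 (st ◅ ss) inv = star-invariant k>0 ss (proj₂ (step-invariant k>0 st inv))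

  halted⇒topK : ∀ {s X} → Invariant s X → ¬ Guard s → ∀ v → v ≢ r → IsTopK k (lists s v)
  halted⇒topK {s} inv halted v v≢r = record
    { distinct = listed-unique v
    ; simple   = T-simple
    ; few      = few
    ; many     = many
    }
    where
    open Invariant inv
    open Invariants inv using (T; unlisted⇒queuedBelow)

    T-simple : All Simple (T v)
    T-simple = tabulate (expanded-simple ∘ listed-expanded)

    unsaturated⇒queue-empty : length (T v) < k → ∀ {p} → p ∉ queue s
    unsaturated⇒queue-empty <k p∈ =
      halted ((λ eq → contradiction (subst (_ ∈_) eq p∈) λ ()) , v , v≢r , <k)

    unsaturated⇒complete : length (T v) < k → ∀ P → Simple P → P ∈ T v
    unsaturated⇒complete <k P sP with DecMembership._∈?_ _≟ₚ_ P (T v)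
    ... | yes P∈ = P∈
    ... | no P∉  with _ , p∈ , _ ← unlisted⇒queuedBelow <k P sP P∉ =
      contradiction p∈ (unsaturated⇒queue-empty <k)

    few : FewerSimplePathsThan k r v → ∀ P → Simple P → P ∈ T v
    few fewer = unsaturated⇒complete (fewer (T v) (listed-unique v) T-simple)

    many : ¬ FewerSimplePathsThan k r v →
           length (T v) ≡ k × (∀ P → Simple P → P ∉ T v → All (λ Q → weight Q ≤ʷ weight P) (T v))
    many ¬fewer = ≤∧≮⇒≡ (listed-≤k v) ≮k
                , λ P sP P∉ → tabulate (listed-optimal (≮⇒≥ ≮k) P sP P∉)
      where
      ≮k : ¬ length (T v) < k
      ≮k <k = ¬fewer λ Ps u sPs →
        ≤-trans (s≤s (unique-⊆⇒length≤ u λ P∈ → unsaturated⇒complete <k _ (lookup sPs P∈))) <k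

theorem3 : ∀ {c ℓ₁ ℓ₂} (W : WeightDomain c ℓ₁ ℓ₂) (G : Graph W) (r : Graph.V G) (k : ℕ) →
    k > 0 → PrunedSkSSP.SolvesTopKSimpleShortestPaths G r k
theorem3 W G r k k>0 = record
  { terminates = simple-queue⇒acc initial (([] ∷ []) ∷ []) (<-wellFounded _)
  ; progress   = λ _ → guard⇒step _
  ; correct    = λ reach → halted⇒topK (proj₂ (star-invariant k>0 reach (initial-invariant k>0)))
  }
  where open PrunedSkSSP G r k using (initial)
        open Correctness G r k
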